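{- For every even integer $n\geq 4$ and every integer $m\geq 2$, the graph $mW_n$ (the disjoint union of $m$ copies of the wheel $W_n$) is $C_3$-supermagic.
   Context: All graphs are finite and simple. For a graph $H$, a graph $G=(V,E)$ has an $H$-covering if every edge of $G$ belongs to a subgraph of $G$ isomorphic to $H$. For such $G$, an $H$-magic labeling is a bijection $\lambda: V\cup E\to\{1,2,\dots,|V|+|E|\}$ for which there is a constant $c$ such that for every subgraph $H'=(V',E')$ of $G$ isomorphic to $H$, $\sum_{v\in V'}\lambda(v)+\sum_{e\in E'}\lambda(e)=c$. It is $H$-supermagic if moreover $\{\lambda(v):v\in V\}=\{1,\dots,|V|\}$; $G$ is $H$-supermagic if it admits such a labeling. $C_k$ is the cycle of length $k$. $mG$ denotes the disjoint union of $m$ copies of $G$. The wheel $W_n=K_1+C_n$ has vertices $c,v_1,\dots,v_n$ and edges $cv_i$ ($1\le i\le n$) and $v_iv_{i+1}$ ($1\le i\le n$, indices modulo $n$). -}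

module Defs where

open import Algebra.Properties.CommutativeMonoid.Sum using (sum)
open import Data.Bool using (Bool; T; if_then_else_)
open import Data.Bool.Properties using (T-irrelevant)
open import Data.Fin using (Fin; toℕ)
open import Data.Fin.Properties using (1↔⊤; +↔⊎; *↔×; toℕ-injective; toℕ<n; toℕ-fromℕ<)
open import Data.Nat using (ℕ; suc; _+_; _*_; _%_; _≤_)
open import Data.Nat.DivMod using (_mod_; m<n⇒m%n≡m; n%n≡0)
open import Data.Nat.Properties
  using (+-0-commutativeMonoid; ≤-trans; <⇒≢; n<1+n; m≤n⇒m<n∨m≡n; n≤1+n)
open import Data.Product using (Σ; ∃-syntax; _×_; _,_; proj₁; proj₂; swap)
open import Data.Product.Function.NonDependent.Propositional using (_×-↔_)
open import Data.Sum using (_⊎_; inj₁; inj₂; map)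
open import Data.Sum.Function.Propositional using (_⊎-↔_)
open import Data.Sum.Properties using (inj₂-injective)
open import Data.Unit using (⊤; tt)
open import Function using (_∘_)
open import Function.Bundles using (_↔_; _⤖_; _⇔_; module Inverse; module Bijection)
open import Function.Construct.Composition using (_↔-∘_)
open import Function.Construct.Identity using (↔-id)
open import Relation.Binary.PropositionalEquality
  using (_≡_; _≢_; refl; sym; trans; cong; cong₂)
open import Relation.Nullary using (contradiction)

-- Equality of unordered pairs.
infix 4 _≈_
_≈_ : {A : Set} → A × A → A × A → Set
p ≈ q = p ≡ q ⊎ p ≡ swap q

≈-map : {A B : Set} (f : A → B) {a b c d : A} →
        (a , b) ≈ (c , d) → (f a , f b) ≈ (f c , f d)
≈-map f (inj₁ refl) = inj₁ refl
≈-map f (inj₂ refl) = inj₂ refl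

-- The order in which `ends` lists the two endpoints of an edge is immaterial.
record SimpleGraph : Set₁ where
  field
    V E      : Set
    ends     : E → V × V
    loopless : ∀ e → proj₁ (ends e) ≢ proj₂ (ends e)
    simple   : ∀ {e f} → ends e ≈ ends f → e ≡ f

  Adj : V → V → Set
  Adj u v = ∃[ e ] ends e ≈ (u , v)

infix 4 _≅_
record _≅_ (G H : SimpleGraph) : Set where
  private
    module G = SimpleGraph G
    module H = SimpleGraph H
  field
    bijection : G.V ↔ H.V
  open Inverse bijection public using (to; from)
  field
    adjacency : ∀ u v → G.Adj u v ⇔ H.Adj (to u) (to v)

record Graph : Set₁ where
  field
    simpleGraph : SimpleGraph
  open SimpleGraph simpleGraph public
  field
    order size : ℕ
    vertices   : Fin order ↔ V
    edges      : Fin size ↔ E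

-- Not necessarily induced.
record Subgraph (G : Graph) : Set where
  open Graph G
  field
    inV    : V → Bool
    inE    : E → Bool
    closed : ∀ e → T (inE e) → T (inV (proj₁ (ends e))) × T (inV (proj₂ (ends e)))

private
  Σ-T-≡ : {A : Set} {p : A → Bool} {x y : Σ A (T ∘ p)} → proj₁ x ≡ proj₁ y → x ≡ y
  Σ-T-≡ {x = a , s} {y = _ , t} refl = cong (a ,_) (T-irrelevant s t)

⟦_⟧ : {G : Graph} → Subgraph G → SimpleGraph
⟦_⟧ {G} S = record
  { V        = Σ V (T ∘ inV)
  ; E        = Σ E (T ∘ inE)
  ; ends     = λ (e , e∈S) → (proj₁ (ends e) , proj₁ (closed e e∈S))
                           , (proj₂ (ends e) , proj₂ (closed e e∈S))
  ; loopless = λ (e , _) eq → loopless e (cong proj₁ eq)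
  ; simple   = λ eq → Σ-T-≡ (simple (≈-map proj₁ eq))
  }
  where
  open Graph G
  open Subgraph S

IsCopyOf : Graph → {G : Graph} → Subgraph G → Set
IsCopyOf H S = ⟦ S ⟧ ≅ Graph.simpleGraph H

HasCovering : Graph → Graph → Set
HasCovering H G = ∀ e → ∃[ S ] IsCopyOf H {G} S × T (Subgraph.inE S e)

Σ[_] : {n : ℕ} → (Fin n → ℕ) → ℕ
Σ[_] = sum +-0-commutativeMonoid

module _ (G : Graph) where
  open Graph G

  TotalLabeling : Set
  TotalLabeling = (V ⊎ E) ⤖ Fin (order + size)

  -- Labels are 1, …, |V| + |E|, whereas Fin counts from 0.
  label : TotalLabeling → V ⊎ E → ℕ
  label ℓ x = suc (toℕ (Bijection.to ℓ x))

  weight : TotalLabeling → Subgraph G → ℕ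
  weight ℓ S =
      Σ[ (λ i → let v = Inverse.to vertices i in if inV v then label ℓ (inj₁ v) else 0) ]
    + Σ[ (λ j → let e = Inverse.to edges j    in if inE e then label ℓ (inj₂ e) else 0) ]
    where open Subgraph S

  IsMagic : Graph → TotalLabeling → Set
  IsMagic H ℓ = ∃[ c ] (∀ (S : Subgraph G) → IsCopyOf H S → weight ℓ S ≡ c)

  IsSupermagicLabeling : Graph → TotalLabeling → Set
  IsSupermagicLabeling H ℓ =
    IsMagic H ℓ × (∀ k → (∃[ v ] label ℓ (inj₁ v) ≡ k) ⇔ (1 ≤ k × k ≤ order))

IsSupermagic : Graph → Graph → Set
IsSupermagic H G = HasCovering H G × ∃[ ℓ ] IsSupermagicLabeling G H ℓ

-- Cyclic successor.
next : {n : ℕ} → Fin n → Fin n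
next {suc n} i = suc (toℕ i) mod suc n

toℕ-next : {n : ℕ} (i : Fin n) →
           (toℕ (next i) ≡ suc (toℕ i)) ⊎ (suc (toℕ i) ≡ n × toℕ (next i) ≡ 0)
toℕ-next {suc n} i with m≤n⇒m<n∨m≡n (toℕ<n i)
... | inj₁ i+1<n = inj₁ (trans (toℕ-fromℕ< _) (m<n⇒m%n≡m i+1<n))
... | inj₂ i+1≡n = inj₂ (i+1≡n ,
        trans (toℕ-fromℕ< _) (trans (cong (_% suc n) i+1≡n) (n%n≡0 (suc n))))

next-≢ : {n : ℕ} → 2 ≤ n → (i : Fin n) → i ≢ next i
next-≢ 2≤n i i≡ with toℕ-next i
... | inj₁ p       = <⇒≢ (n<1+n (toℕ i)) (trans (cong toℕ i≡) p)
... | inj₂ (p , q) = <⇒≢ 2≤n (trans (cong suc (sym (trans (cong toℕ i≡) q))) p)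

next²-≢ : {n : ℕ} → 3 ≤ n → (i : Fin n) → i ≢ next (next i)
next²-≢ 3≤n i i≡ with toℕ-next i | toℕ-next (next i)
... | inj₁ p | inj₁ q =
        <⇒≢ (≤-trans (n<1+n (toℕ i)) (n≤1+n _))
            (trans (cong toℕ i≡) (trans q (cong suc p)))
... | inj₁ p | inj₂ (q , r) =
        <⇒≢ 3≤n (trans (cong (suc ∘ suc) (sym (trans (cong toℕ i≡) r)))
                       (trans (cong suc (sym p)) q))
... | inj₂ (p , q) | inj₁ r =
        <⇒≢ 3≤n (trans (cong suc (sym (trans (cong toℕ i≡) (trans r (cong suc q))))) p)
... | inj₂ (p , q) | inj₂ (r , _) =
        <⇒≢ (≤-trans (n≤1+n 2) 3≤n) (trans (cong suc (sym q)) r)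

cycle : (n : ℕ) → 3 ≤ n → Graph
cycle n 3≤n = record
  { simpleGraph = record
    { V        = Fin n
    ; E        = Fin n
    ; ends     = λ i → i , next i
    ; loopless = next-≢ (≤-trans (n≤1+n 2) 3≤n)
    ; simple   = λ where
        (inj₁ eq) → cong proj₁ eq
        (inj₂ eq) → contradiction
          (trans (cong proj₁ eq) (cong next (sym (cong proj₂ eq))))
          (next²-≢ 3≤n _)
    }
  ; order    = n
  ; size     = n
  ; vertices = ↔-id _
  ; edges    = ↔-id _
  }

-- The join with a single new vertex, inj₁ tt; the edge inj₁ v joins it to v.
K₁+_ : Graph → Graph
K₁+ G = record
  { simpleGraph = record
    { V        = ⊤ ⊎ V
    ; E        = V ⊎ E
    ; ends     = ends′
    ; loopless = λ where
        (inj₁ v) ()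
        (inj₂ e) eq → loopless e (inj₂-injective eq)
    ; simple   = λ {e} {f} → simple′ e f
    }
  ; order    = 1 + order
  ; size     = order + size
  ; vertices = (1↔⊤ ⊎-↔ vertices) ↔-∘ +↔⊎
  ; edges    = (vertices ⊎-↔ edges) ↔-∘ +↔⊎
  }
  where
  open Graph G
  ends′ : V ⊎ E → (⊤ ⊎ V) × (⊤ ⊎ V)
  ends′ (inj₁ v) = inj₁ tt , inj₂ v
  ends′ (inj₂ e) = inj₂ (proj₁ (ends e)) , inj₂ (proj₂ (ends e))

  simple′ : ∀ e f → ends′ e ≈ ends′ f → e ≡ f
  simple′ (inj₁ u) (inj₁ v) (inj₁ refl) = refl
  simple′ (inj₁ u) (inj₁ v) (inj₂ ())
  simple′ (inj₁ u) (inj₂ f) (inj₁ ())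
  simple′ (inj₁ u) (inj₂ f) (inj₂ ())
  simple′ (inj₂ e) (inj₁ v) (inj₁ ())
  simple′ (inj₂ e) (inj₁ v) (inj₂ ())
  simple′ (inj₂ e) (inj₂ f) eq = cong inj₂ (simple (map
    (λ p → cong₂ _,_ (inj₂-injective (cong proj₁ p)) (inj₂-injective (cong proj₂ p)))
    (λ p → cong₂ _,_ (inj₂-injective (cong proj₁ p)) (inj₂-injective (cong proj₂ p)))
    eq))

wheel : (n : ℕ) → 3 ≤ n → Graph
wheel n 3≤n = K₁+ cycle n 3≤n

copies : ℕ → Graph → Graph
copies m G = record
  { simpleGraph = record
    { V        = Fin m × V
    ; E        = Fin m × E
    ; ends     = λ (i , e) → (i , proj₁ (ends e)) , (i , proj₂ (ends e))
    ; loopless = λ (_ , e) eq → loopless e (cong proj₂ eq)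
    ; simple   = λ eq → cong₂ _,_ (same-copy eq) (simple (≈-map proj₂ eq))
    }
  ; order    = m * order
  ; size     = m * size
  ; vertices = (↔-id _ ×-↔ vertices) ↔-∘ *↔×
  ; edges    = (↔-id _ ×-↔ edges) ↔-∘ *↔×
  }
  where
  open Graph G
  same-copy : {i j : Fin m} {a b c d : V} →
              ((i , a) , (i , b)) ≈ ((j , c) , (j , d)) → i ≡ j
  same-copy (inj₁ refl) = refl
  same-copy (inj₂ refl) = refl

{-# OPTIONS --safe #-}

-- With labels counted from 0, a labelling of W_n (n even) is C₃-supermagic when
-- c + a_i + a_{i+1} + r_i is constant, where c is the label of the hub, r_i that of the rim edge
-- v_i v_{i+1}, and a_i is the sum of the labels of v_i and of its spoke. Such a labelling f of W_n
-- gives one of mW_n: use m f(v) + j for the vertices and m f(e) + (m − 1 − j) for the edges of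
-- copy j; since a triangle has three vertices and three edges, j cancels.
--
-- Write n = n₀ + 4g with n₀ ∈ {0, 6}. In the t-th run of four consecutive rim vertices the labels
-- are affine in t, with a_0 = 4g + n₀ and a_2 = a_0 − 1 constant, a_1 and a_3 of slope 2, and all
-- r_i of slope −2, so that runs can be inserted before a rim vertex with a_i = 4g + n₀; for n₀ = 6
-- this is the first vertex of a labelling of W_6.

module Submission where

open import Defs
open import Algebra.Properties.CommutativeMonoid.Sum
  using (sum-cong-≗; sum-replicate-zero; ∑-comm)
open import Data.Bool using (Bool; true; false; T; if_then_else_)
open import Data.Bool.Properties using (T-irrelevant)
open import Data.Empty using (⊥; ⊥-elim)
open import Data.Fin using (Fin; zero; suc; toℕ; fromℕ<; opposite)
open import Data.Fin.Patterns using (0F; 1F; 2F; 3F; 4F; 5F; 6F; 7F; 8F)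
open import Data.Fin.Properties
  using (_≟_; any?; all?; toℕ-injective; toℕ<n; toℕ-fromℕ<; toℕ-↑ˡ; toℕ-↑ʳ; toℕ-combine;
         opposite-involutive; opposite-prop; 1↔⊤; +↔⊎; *↔×)
open import Data.List using (List; []; _∷_; lookup)
open import Data.Nat using (ℕ; zero; suc; _+_; _*_; _∸_; _≤_; s≤s; z≤n; _<?_)
open import Data.Nat.Divisibility using (_∣_; divides)
open import Data.Nat.Properties
  using (+-0-commutativeMonoid; +-identityʳ; +-assoc; +-comm; *-comm; +-monoʳ-≤; *-monoʳ-≤;
         ≤-refl; ≤-trans; <⇒≤; <⇒≢; ≮⇒≥; ≤⇒≯; m+[n∸m]≡n; m+n∸n≡m; m+n≡0⇒n≡0; m≢1+n+m)
open import Data.Nat.Tactic.RingSolver using (solve; solve-∀)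
open import Data.Product using (Σ; ∃-syntax; _×_; _,_; proj₁; proj₂)
open import Data.Product.Function.NonDependent.Propositional using (_×-↔_)
open import Data.Sum using (_⊎_; inj₁; inj₂; [_,_]) renaming (map to map-⊎)
open import Data.Sum.Function.Propositional using (_⊎-↔_)
open import Data.Sum.Properties using (≡-dec)
open import Data.Unit using (⊤; tt)
open import Function using (_∘_; Injective)
open import Function.Bundles
  using (_↔_; _⇔_; mk↔ₛ′; mk⇔; module Injection; module Inverse; module Equivalence)
open import Function.Construct.Composition using (_↔-∘_)
open import Function.Construct.Identity using (↔-id)
open import Function.Properties.Inverse using (↔-sym; ↔⇒↣; ↔⇒⤖)
open import Function.Related.TypeIsomorphisms using (×-comm)
open import Relation.Binary using (DecidableEquality)
open import Relation.Binary.PropositionalEquality hiding ([_])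
open import Relation.Nullary using (Dec; does; yes; no; contradiction)
open import Relation.Nullary.Decidable
  using (dec-true; dec-false; via-injection; isYes; toWitness; fromWitness)

-- Unordered pairs and subsets cut out by Boolean predicates.

≈-sym : {A : Set} {p q : A × A} → p ≈ q → q ≈ p
≈-sym (inj₁ refl) = inj₁ refl
≈-sym (inj₂ refl) = inj₂ refl

≈-trans : {A : Set} {p q r : A × A} → p ≈ q → q ≈ r → p ≈ r
≈-trans (inj₁ refl) q≈r         = q≈r
≈-trans (inj₂ refl) (inj₁ refl) = inj₂ refl
≈-trans (inj₂ refl) (inj₂ refl) = inj₁ refl

≈-injective : {A B : Set} {f : A → B} → Injective _≡_ _≡_ f → ∀ {a b c d} →
              (f a , f b) ≈ (f c , f d) → (a , b) ≈ (c , d)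
≈-injective inj (inj₁ eq) = inj₁ (cong₂ _,_ (inj (cong proj₁ eq)) (inj (cong proj₂ eq)))
≈-injective inj (inj₂ eq) = inj₂ (cong₂ _,_ (inj (cong proj₁ eq)) (inj (cong proj₂ eq)))

Σ-T-≡ : {A : Set} (p : A → Bool) {x y : Σ A (T ∘ p)} → proj₁ x ≡ proj₁ y → x ≡ y
Σ-T-≡ p {a , s} {_ , t} refl = cong (a ,_) (T-irrelevant s t)

-- Sums over the image of an injection.

sum-δ : ∀ {n} (f : Fin n → ℕ) j → Σ[ (λ i → if does (i ≟ j) then f i else 0) ] ≡ f j
sum-δ {suc n} f zero =
  trans (cong (f zero +_) (sum-replicate-zero +-0-commutativeMonoid n)) (+-identityʳ _)
sum-δ f (suc j) = sum-δ (f ∘ suc) j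

-- Double counting: as `q` is injective with image `p`, the guarded term at `i` is a sum over `j` of
-- terms supported on `i ≡ q j`. Exchanging the sums leaves one delta sum for each `j`.
sum-image : ∀ {n k} (p : Fin n → Bool) (f : Fin n → ℕ) (q : Fin k → Fin n) →
            Injective _≡_ _≡_ q →
            (∀ j → T (p (q j))) → (∀ i → T (p i) → ∃[ j ] q j ≡ i) →
            Σ[ (λ i → if p i then f i else 0) ] ≡ Σ[ f ∘ q ]
sum-image {n} {k} p f q q-inj q∈p p⊆q = begin
  Σ[ (λ i → if p i then f i else 0) ]
    ≡⟨ sum-cong-≗ +-0-commutativeMonoid (λ i → fibre i (p i) refl) ⟩
  Σ[ (λ i → Σ[ (λ j → if does (i ≟ q j) then f i else 0) ]) ]
    ≡⟨ ∑-comm +-0-commutativeMonoid {n} {k} (λ i j → if does (i ≟ q j) then f i else 0) ⟩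
  Σ[ (λ j → Σ[ (λ i → if does (i ≟ q j) then f i else 0) ]) ]
    ≡⟨ sum-cong-≗ +-0-commutativeMonoid (λ j → sum-δ f (q j)) ⟩
  Σ[ f ∘ q ] ∎
  where
  open ≡-Reasoning
  does-q : ∀ j l → does (q j ≟ q l) ≡ does (l ≟ j)
  does-q j l with l ≟ j
  ... | yes refl = dec-true (q j ≟ q j) refl
  ... | no  l≢j  = dec-false (q j ≟ q l) (λ eq → l≢j (sym (q-inj eq)))

  fibre : ∀ i b → p i ≡ b → (if b then f i else 0) ≡
          Σ[ (λ j → if does (i ≟ q j) then f i else 0) ]
  fibre i true pi with p⊆q i (subst T (sym pi) tt)
  ... | j , refl = sym (trans
    (sum-cong-≗ +-0-commutativeMonoid λ l → cong (if_then f (q j) else 0) (does-q j l))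
    (sum-δ (λ _ → f (q j)) j))
  fibre i false pi = sym (trans
    (sum-cong-≗ +-0-commutativeMonoid λ j → cong (if_then f i else 0)
      (dec-false (i ≟ q j) λ { refl → subst T pi (q∈p j) }))
    (sum-replicate-zero +-0-commutativeMonoid k))

-- The form that fits `weight`, which runs over the enumerations of all vertices and edges of the
-- graph.
sum-restrict : ∀ {n k} {A : Set} (index : Fin n ↔ A) (p : A → Bool) (f : A → ℕ) (q : Fin k → A) →
               Injective _≡_ _≡_ q →
               (∀ j → T (p (q j))) → (∀ a → T (p a) → ∃[ j ] q j ≡ a) →
               Σ[ (λ i → let a = Inverse.to index i in if p a then f a else 0) ] ≡ Σ[ f ∘ q ]
sum-restrict index p f q q-inj q∈p p⊆q = trans
  (sum-image (p ∘ to) (f ∘ to) (from ∘ q)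
    (λ eq → q-inj (trans (sym (strictlyInverseˡ _)) (trans (cong to eq) (strictlyInverseˡ _))))
    (λ j → subst (T ∘ p) (sym (strictlyInverseˡ _)) (q∈p j))
    (λ i pi → let j , eq = p⊆q (to i) pi in j , trans (cong from eq) (strictlyInverseʳ i)))
  (sum-cong-≗ +-0-commutativeMonoid (λ j → cong f (strictlyInverseˡ (q j))))
  where open Inverse index

-- Copies of a cycle as cyclic sequences of vertices and edges.

module _ {k : ℕ} (3≤k : 3 ≤ k) (G : Graph) where
  open Graph G

  private
    Cₖ : Graph
    Cₖ = cycle k 3≤k

  -- A closed walk of length `k`. Distinctness of the corners is a separate hypothesis, automatic
  -- for triangles.
  record CycleIn : Set where
    field
      corner   : Fin k → V
      side     : Fin k → E
      incident : ∀ i → ends (side i) ≈ (corner i , corner (next i))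

  open CycleIn

  cycleWeight : (V → ℕ) → (E → ℕ) → CycleIn → ℕ
  cycleWeight f g C = Σ[ f ∘ corner C ] + Σ[ g ∘ side C ]

  -- Equal sides have equal ends; injectivity of the corners pulls this back to two edges of the
  -- cycle with the same ends, and the cycle is simple.
  side-injective : ∀ C → Injective _≡_ _≡_ (corner C) → Injective _≡_ _≡_ (side C)
  side-injective C corner-injective {i} {j} eq = Graph.simple Cₖ
    (≈-injective corner-injective
      (≈-trans (≈-sym (incident C i))
               (subst (λ e → ends e ≈ _) (sym eq) (incident C j))))

  module _ (S : Subgraph G) (S≅Cₖ : IsCopyOf Cₖ S) where
    open Subgraph S
    open _≅_ S≅Cₖ
    private
      module B = Inverse bijection
      module S = SimpleGraph ⟦ S ⟧

      sideIn : ∀ i → S.Adj (from i) (from (next i))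
      sideIn i = Equivalence.from (adjacency _ _)
        (i , inj₁ (sym (cong₂ _,_ (B.strictlyInverseˡ i) (B.strictlyInverseˡ (next i)))))

    copy⇒cycle : CycleIn
    copy⇒cycle = record
      { corner   = proj₁ ∘ from
      ; side     = proj₁ ∘ proj₁ ∘ sideIn
      ; incident = λ i → ≈-map proj₁ (proj₂ (sideIn i))
      }

    private
      corner-injective : Injective _≡_ _≡_ (corner copy⇒cycle)
      corner-injective eq = Injection.injective (↔⇒↣ (↔-sym bijection)) (Σ-T-≡ inV eq)

      corner-onto : ∀ v → T (inV v) → ∃[ i ] corner copy⇒cycle i ≡ v
      corner-onto v v∈S = to (v , v∈S) , cong proj₁ (B.strictlyInverseʳ (v , v∈S))

      -- The isomorphism sends the ends of `e` to adjacent vertices of the cycle, so `e` has the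
      -- same ends as some side; simplicity of `G` identifies the two.
      side-onto : ∀ e → T (inE e) → ∃[ i ] side copy⇒cycle i ≡ e
      side-onto e e∈S =
        let i , i≈ = Equivalence.to (adjacency x y) ((e , e∈S) , inj₁ refl)
        in  i , simple (≈-trans (incident copy⇒cycle i)
                  (≈-map proj₁ (≈-trans (≈-map from i≈)
                    (inj₁ (cong₂ _,_ (B.strictlyInverseʳ x) (B.strictlyInverseʳ y))))))
        where
        x y : S.V
        x = proj₁ (ends e) , proj₁ (closed e e∈S)
        y = proj₂ (ends e) , proj₂ (closed e e∈S)

    weight-copy : ∀ ℓ → weight G ℓ S ≡
                  cycleWeight (label G ℓ ∘ inj₁) (label G ℓ ∘ inj₂) copy⇒cycle
    weight-copy ℓ = cong₂ _+_
      (sum-restrict vertices inV (label G ℓ ∘ inj₁) (corner copy⇒cycle)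
        corner-injective (proj₂ ∘ from) corner-onto)
      (sum-restrict edges inE (label G ℓ ∘ inj₂) (side copy⇒cycle)
        (side-injective copy⇒cycle corner-injective) (proj₂ ∘ proj₁ ∘ sideIn) side-onto)

  module _ (C : CycleIn) (corner-injective : Injective _≡_ _≡_ (corner C)) where
    private
      infix 4 _≟V_ _≟E_
      _≟V_ : DecidableEquality V
      _≟V_ = via-injection (↔⇒↣ (↔-sym vertices)) _≟_

      _≟E_ : DecidableEquality E
      _≟E_ = via-injection (↔⇒↣ (↔-sym edges)) _≟_

      corner? : ∀ v → Dec (∃[ i ] corner C i ≡ v)
      corner? v = any? λ i → corner C i ≟V v

      side? : ∀ e → Dec (∃[ i ] side C i ≡ e)
      side? e = any? λ i → side C i ≟E e

      ends-corners : ∀ {e u v} → ∃[ i ] side C i ≡ e → ends e ≈ (u , v) →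
                     (∃[ i ] corner C i ≡ u) × (∃[ i ] corner C i ≡ v)
      ends-corners (i , refl) e≈ with ≈-trans (≈-sym (incident C i)) e≈
      ... | inj₁ refl = (i , refl) , (next i , refl)
      ... | inj₂ refl = (next i , refl) , (i , refl)

    -- This direction serves the covering; weights go through `copy⇒cycle`. Membership is a search
    -- through the `k` corners or sides, with equality decided via the enumerations of `V` and `E`.
    cycle⇒subgraph : Subgraph G
    cycle⇒subgraph = record
      { inV    = λ v → isYes (corner? v)
      ; inE    = λ e → isYes (side? e)
      ; closed = λ e e∈C →
          let u , v = ends-corners (toWitness e∈C) (inj₁ refl)
          in  fromWitness u , fromWitness v
      }

    side∈subgraph : ∀ i → T (Subgraph.inE cycle⇒subgraph (side C i))
    side∈subgraph i = fromWitness (i , refl)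

    private
      module S = SimpleGraph ⟦ cycle⇒subgraph ⟧

      bij : S.V ↔ Fin k
      bij = mk↔ₛ′ (λ (v , v∈C) → proj₁ (toWitness v∈C)) (λ i → corner C i , fromWitness (i , refl))
        (λ i → corner-injective (proj₂ (toWitness {a? = corner? (corner C i)} _)))
        (λ (v , v∈C) → Σ-T-≡ (Subgraph.inV cycle⇒subgraph) (proj₂ (toWitness v∈C)))

      open Inverse bij

      corner-to : ∀ u → corner C (to u) ≡ proj₁ u
      corner-to u = cong proj₁ (strictlyInverseʳ u)

      adj : ∀ u v → S.Adj u v ⇔ Graph.Adj Cₖ (to u) (to v)
      adj u v = mk⇔ to-adj from-adj
        where
        to-adj : S.Adj u v → Graph.Adj Cₖ (to u) (to v)
        to-adj ((e , e∈C) , e≈) with toWitness e∈C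
        ... | i , refl = i , ≈-injective corner-injective
          (≈-trans (≈-sym (incident C i))
            (≈-trans (≈-map proj₁ e≈) (inj₁ (sym (cong₂ _,_ (corner-to u) (corner-to v))))))

        from-adj : Graph.Adj Cₖ (to u) (to v) → S.Adj u v
        from-adj (i , i≈) = (side C i , side∈subgraph i) ,
          ≈-injective (Σ-T-≡ _) (≈-trans (incident C i)
            (≈-trans (≈-map (corner C) i≈) (inj₁ (cong₂ _,_ (corner-to u) (corner-to v)))))

    subgraph-isCopy : IsCopyOf Cₖ cycle⇒subgraph
    subgraph-isCopy = record { bijection = bij ; adjacency = adj }

-- Bijections onto initial segments with prescribed values.

-- Couples a bijection onto `Fin n` with an arithmetic formula for it, so that labelings can be
-- assembled from blocks while their values stay open to ring identities.
record Numbers {A : Set} (f : A → ℕ) (n : ℕ) : Set where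
  field
    index   : A ↔ Fin n
  open Inverse index public
  field
    toℕ-to : ∀ a → toℕ (to a) ≡ f a

  value : A → ℕ
  value = f

  bounded : ∀ a → suc (f a) ≤ n
  bounded a = subst (λ k → suc k ≤ n) (toℕ-to a) (toℕ<n (to a))

  toℕ-from : ∀ i → f (from i) ≡ toℕ i
  toℕ-from i = trans (sym (toℕ-to (from i))) (cong toℕ (strictlyInverseˡ i))

transport : ∀ {A B : Set} {f : B → ℕ} {n} (A↔B : A ↔ B) → Numbers f n →
            Numbers (f ∘ Inverse.to A↔B) n
transport A↔B F = record
  { index  = Numbers.index F ↔-∘ A↔B
  ; toℕ-to = Numbers.toℕ-to F ∘ Inverse.to A↔B
  }

toℕ-numbers : ∀ {n} → Numbers (toℕ {n}) n
toℕ-numbers = record { index = ↔-id _ ; toℕ-to = λ _ → refl }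

opposite-numbers : ∀ {n} → Numbers (toℕ ∘ opposite {n}) n
opposite-numbers = transport
  (mk↔ₛ′ opposite opposite opposite-involutive opposite-involutive) toℕ-numbers

toℕ+opposite : ∀ {n} (i : Fin n) → suc (toℕ i + toℕ (opposite i)) ≡ n
toℕ+opposite i = trans (cong (suc (toℕ i) +_) (opposite-prop i)) (m+[n∸m]≡n (toℕ<n i))

module _ {A B : Set} {f : A → ℕ} {g : B → ℕ} {m n : ℕ} where
  infixr 5 _⊎-numbers_
  infixr 6 _×-numbers_

  _⊎-numbers_ : Numbers f m → Numbers g n → Numbers [ f , (m +_) ∘ g ] (m + n)
  F ⊎-numbers G = record
    { index  = ↔-sym +↔⊎ ↔-∘ (F.index ⊎-↔ G.index)
    ; toℕ-to = λ where
        (inj₁ a) → trans (toℕ-↑ˡ (F.to a) n) (F.toℕ-to a)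
        (inj₂ b) → trans (toℕ-↑ʳ m (G.to b)) (cong (m +_) (G.toℕ-to b))
    }
    where
    module F = Numbers F
    module G = Numbers G

  _×-numbers_ : Numbers f m → Numbers g n → Numbers (λ (a , b) → n * f a + g b) (m * n)
  F ×-numbers G = record
    { index  = ↔-sym *↔× ↔-∘ (F.index ×-↔ G.index)
    ; toℕ-to = λ (a , b) → trans (toℕ-combine (F.to a) (G.to b))
                 (cong₂ (λ x y → n * x + y) (F.toℕ-to a) (G.toℕ-to b))
    }
    where
    module F = Numbers F
    module G = Numbers G

-- Triangles and supermagic labelings.

TriangleIn : Graph → Set
TriangleIn = CycleIn ≤-refl

module TriangleIn {G : Graph} = CycleIn {3≤k = ≤-refl} {G = G}
open TriangleIn

triangleWeight : (G : Graph) → (Graph.V G → ℕ) → (Graph.E G → ℕ) → TriangleIn G → ℕ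
triangleWeight = cycleWeight ≤-refl

-- Any two distinct elements of `Fin 3` are cyclically consecutive, so looplessness alone separates
-- the corners.
triangle-injective : ∀ {G} (Δ : TriangleIn G) → Injective _≡_ _≡_ (corner Δ)
triangle-injective {G} Δ {i} {j} = cases i j
  where
  open Graph G
  distinct : ∀ i → corner Δ i ≢ corner Δ (next i)
  distinct i eq with incident Δ i
  ... | inj₁ ends≡ = loopless (side Δ i)
    (trans (cong proj₁ ends≡) (trans eq (sym (cong proj₂ ends≡))))
  ... | inj₂ ends≡ = loopless (side Δ i)
    (trans (cong proj₁ ends≡) (trans (sym eq) (sym (cong proj₂ ends≡))))

  cases : ∀ i j → corner Δ i ≡ corner Δ j → i ≡ j
  cases 0F 0F _  = refl
  cases 1F 1F _  = refl
  cases 2F 2F _  = refl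
  cases 0F 1F eq = contradiction eq (distinct 0F)
  cases 1F 2F eq = contradiction eq (distinct 1F)
  cases 2F 0F eq = contradiction eq (distinct 2F)
  cases 1F 0F eq = contradiction (sym eq) (distinct 0F)
  cases 2F 1F eq = contradiction (sym eq) (distinct 1F)
  cases 0F 2F eq = contradiction (sym eq) (distinct 2F)

TriangleCovered : Graph → Set
TriangleCovered G = ∀ e → ∃[ Δ ] ∃[ i ] side {G} Δ i ≡ e

TriangleMagic : (G : Graph) → (Graph.V G → ℕ) → (Graph.E G → ℕ) → Set
TriangleMagic G f g = ∃[ c ] (∀ Δ → triangleWeight G f g Δ ≡ c)

module _ (G : Graph) where
  open Graph G

  triangleCovered⇒hasCovering : TriangleCovered G → HasCovering (cycle 3 ≤-refl) G
  triangleCovered⇒hasCovering covered e with Δ , i , refl ← covered e =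
    cycle⇒subgraph ≤-refl G Δ inj , subgraph-isCopy ≤-refl G Δ inj , side∈subgraph ≤-refl G Δ inj i
    where
    inj : Injective _≡_ _≡_ (corner Δ)
    inj = triangle-injective Δ

  triangleMagic⇒supermagic :
    ∀ {f g} → Numbers f order → Numbers g size →
    TriangleCovered G → TriangleMagic G f g → IsSupermagic (cycle 3 ≤-refl) G
  triangleMagic⇒supermagic {f} {g} F H covered (c , magic) =
    triangleCovered⇒hasCovering covered , ℓ ,
    -- All six labels shift by one because they start at 1, and the three edge labels lie above the
    -- `order` vertex labels.
    (c + (6 + 3 * order) , weight-const) , vertex-labels
    where
    module F = Numbers F

    labels : Numbers [ f , (order +_) ∘ g ] (order + size)
    labels = F ⊎-numbers H

    ℓ : TotalLabeling G
    ℓ = ↔⇒⤖ (Numbers.index labels)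

    label≡ : ∀ x → label G ℓ x ≡ suc ([ f , (order +_) ∘ g ] x)
    label≡ x = cong suc (Numbers.toℕ-to labels x)

    regroup : ∀ n a b c d e f →
      suc a + (suc b + (suc c + 0)) + (suc (n + d) + (suc (n + e) + (suc (n + f) + 0))) ≡
      a + (b + (c + 0)) + (d + (e + (f + 0))) + (6 + 3 * n)
    regroup = solve-∀

    weight-const : ∀ S → IsCopyOf (cycle 3 ≤-refl) S → weight G ℓ S ≡ c + (6 + 3 * order)
    weight-const S S≅C₃ = begin
      weight G ℓ S
        ≡⟨ weight-copy ≤-refl G S S≅C₃ ℓ ⟩
      triangleWeight G (label G ℓ ∘ inj₁) (label G ℓ ∘ inj₂) Δ
        ≡⟨ cong₂ _+_
             (cong₂ _+_ (vertex 0F) (cong₂ _+_ (vertex 1F) (cong (_+ 0) (vertex 2F))))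
             (cong₂ _+_ (edge 0F) (cong₂ _+_ (edge 1F) (cong (_+ 0) (edge 2F)))) ⟩
      triangleWeight G (λ v → suc (f v)) (λ e → suc (order + g e)) Δ
        ≡⟨ regroup order (f (corner Δ 0F)) (f (corner Δ 1F)) (f (corner Δ 2F))
                     (g (side Δ 0F)) (g (side Δ 1F)) (g (side Δ 2F)) ⟩
      triangleWeight G f g Δ + (6 + 3 * order)
        ≡⟨ cong (_+ (6 + 3 * order)) (magic Δ) ⟩
      c + (6 + 3 * order) ∎
      where
      open ≡-Reasoning
      Δ : TriangleIn G
      Δ = copy⇒cycle ≤-refl G S S≅C₃
      vertex : ∀ i → label G ℓ (inj₁ (corner Δ i)) ≡ suc (f (corner Δ i))
      vertex i = label≡ (inj₁ (corner Δ i))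
      edge : ∀ i → label G ℓ (inj₂ (side Δ i)) ≡ suc (order + g (side Δ i))
      edge i = label≡ (inj₂ (side Δ i))

    vertex-labels : ∀ k → (∃[ v ] label G ℓ (inj₁ v) ≡ k) ⇔ (1 ≤ k × k ≤ order)
    vertex-labels k = mk⇔
      (λ { (v , refl) → s≤s z≤n , subst (_≤ order) (sym (label≡ (inj₁ v))) (F.bounded v) })
      (λ { (s≤s _ , k≤order) → F.from (fromℕ< k≤order) ,
           trans (label≡ (inj₁ _)) (cong suc (trans (F.toℕ-from _) (toℕ-fromℕ< k≤order))) })

-- From a graph to its disjoint copies.

module _ (m : ℕ) (G : Graph) where
  open Graph G

  copyVertexLabel : (V → ℕ) → Fin m × V → ℕ
  copyVertexLabel f (j , v) = m * f v + toℕ j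

  copyEdgeLabel : (E → ℕ) → Fin m × E → ℕ
  copyEdgeLabel g (j , e) = m * g e + toℕ (opposite j)

  copyVertexLabel-numbers : ∀ {f} → Numbers f order → Numbers (copyVertexLabel f) (m * order)
  copyVertexLabel-numbers F = subst (Numbers _) (*-comm order m)
    (transport (×-comm _ _) (F ×-numbers toℕ-numbers))

  copyEdgeLabel-numbers : ∀ {g} → Numbers g size → Numbers (copyEdgeLabel g) (m * size)
  copyEdgeLabel-numbers F = subst (Numbers _) (*-comm size m)
    (transport (×-comm _ _) (F ×-numbers opposite-numbers))

  copies-covered : TriangleCovered G → TriangleCovered (copies m G)
  copies-covered covered (j , e) with Δ , i , refl ← covered e = record
    { corner   = λ i → j , corner Δ i
    ; side     = λ i → j , side Δ i
    ; incident = λ i → ≈-map (j ,_) (incident Δ i)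
    } , i , refl

  copies-magic : ∀ {f g} → TriangleMagic G f g →
                 TriangleMagic (copies m G) (copyVertexLabel f) (copyEdgeLabel g)
  -- Each of the three pairs `toℕ j`, `toℕ (opposite j)` contributes m - 1. The identity is proved
  -- with 3 added on both sides, so that each pair contributes `m`.
  copies-magic {f} {g} (c , magic) = m * c + 3 * m ∸ 3 , λ Δ →
    trans (sym (m+n∸n≡m (triangleWeight (copies m G) f′ g′ Δ) 3)) (cong (_∸ 3) (weight+3 Δ))
    where
    f′ : Fin m × V → ℕ
    f′ = copyVertexLabel f

    g′ : Fin m × E → ℕ
    g′ = copyEdgeLabel g

    regroup : ∀ m a₀ a₁ a₂ b₀ b₁ b₂ j₀ j₁ j₂ k₀ k₁ k₂ →
      m * a₀ + j₀ + (m * a₁ + j₁ + (m * a₂ + j₂ + 0)) +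
        (m * b₀ + k₀ + (m * b₁ + k₁ + (m * b₂ + k₂ + 0))) + 3 ≡
      m * (a₀ + (a₁ + (a₂ + 0)) + (b₀ + (b₁ + (b₂ + 0)))) +
        (suc (j₀ + k₀) + (suc (j₁ + k₁) + (suc (j₂ + k₂) + 0)))
    regroup = solve-∀

    weight+3 : ∀ Δ → triangleWeight (copies m G) f′ g′ Δ + 3 ≡ m * c + 3 * m
    weight+3 Δ = trans
      (regroup m (a 0F) (a 1F) (a 2F) (b 0F) (b 1F) (b 2F)
        (j 0F) (j 1F) (j 2F) (l 0F) (l 1F) (l 2F))
      (cong₂ (λ x y → m * x + y) (magic Δ′)
        (cong₂ _+_ (shift 0F) (cong₂ _+_ (shift 1F) (cong₂ _+_ (shift 2F) refl))))
      where
      a b j l : Fin 3 → ℕ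
      a i = f (proj₂ (corner Δ i))
      b i = g (proj₂ (side Δ i))
      j i = toℕ (proj₁ (corner Δ i))
      l i = toℕ (opposite (proj₁ (side Δ i)))

      Δ′ : TriangleIn G
      Δ′ = record
        { corner   = proj₂ ∘ corner Δ
        ; side     = proj₂ ∘ side Δ
        ; incident = λ i → ≈-map proj₂ (incident Δ i)
        }

      -- An edge lies in the same copy as its ends, so corner `i` can be paired with side `i` to
      -- cancel the copy index.
      same-copy : ∀ i → proj₁ (side Δ i) ≡ proj₁ (corner Δ i)
      same-copy i with incident Δ i
      ... | inj₁ eq = cong (proj₁ ∘ proj₁) eq
      ... | inj₂ eq = cong (proj₁ ∘ proj₂) eq

      shift : ∀ i → suc (j i + l i) ≡ m
      shift i rewrite same-copy i = toℕ+opposite (proj₁ (corner Δ i))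

  copies-supermagic :
    ∀ {f g} → Numbers f order → Numbers g size →
    TriangleCovered G → TriangleMagic G f g → IsSupermagic (cycle 3 ≤-refl) (copies m G)
  copies-supermagic {f} {g} F H covered magic = triangleMagic⇒supermagic (copies m G)
    (copyVertexLabel-numbers F) (copyEdgeLabel-numbers H)
    (copies-covered covered) (copies-magic {f} {g} magic)

-- Cycles of length at least four contain no triangle.

-- Split on which of the three steps wrap around. Without a wrap the index grows by 3; a single wrap
-- that returns to `i` forces `n ≡ 3`; two wraps force `n ≤ 2`.
next³-≢ : ∀ {n} → 4 ≤ n → (i : Fin n) → next (next (next i)) ≢ i
next³-≢ 4≤n i eq with toℕ-next i | toℕ-next (next i) | toℕ-next (next (next i)) | cong toℕ eq
next³-≢ 4≤n i eq | inj₁ p | inj₁ q | inj₁ r | s =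
  m≢1+n+m (toℕ i) {2} (trans (sym s) (trans r (cong suc (trans q (cong suc p)))))
next³-≢ 4≤n i eq | inj₁ p | inj₁ q | inj₂ (r , r′) | s = <⇒≢ 4≤n
  (trans (cong (3 +_) (trans (sym r′) s)) (trans (cong suc (sym (trans q (cong suc p)))) r))
next³-≢ 4≤n i eq | inj₁ p | inj₂ (q , q′) | inj₁ r | s = <⇒≢ 4≤n
  (trans (cong (2 +_) (trans (cong suc (sym q′)) (trans (sym r) s))) (trans (cong suc (sym p)) q))
next³-≢ 4≤n i eq | inj₂ (p , p′) | inj₁ q | inj₁ r | s = <⇒≢ 4≤n
  (trans (cong suc (trans (cong (2 +_) (sym p′)) (trans (cong suc (sym q)) (trans (sym r) s)))) p)
next³-≢ 4≤n i eq | inj₁ _ | inj₂ (_ , q′) | inj₂ (r , _) | _ =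
  <⇒≢ (≤-trans (s≤s (s≤s z≤n)) 4≤n) (trans (cong suc (sym q′)) r)
next³-≢ 4≤n i eq | inj₂ (_ , p′) | inj₂ (q , _) | _ | _ =
  <⇒≢ (≤-trans (s≤s (s≤s z≤n)) 4≤n) (trans (cong suc (sym p′)) q)
next³-≢ 4≤n i eq | inj₂ (_ , p′) | inj₁ q | inj₂ (r , _) | _ =
  <⇒≢ (≤-trans (s≤s (s≤s (s≤s z≤n))) 4≤n) (trans (cong suc (trans (cong suc (sym p′)) (sym q))) r)

Arc : ∀ {n} → Fin n → Fin n → Set
Arc u v = next u ≡ v ⊎ next v ≡ u

-- A triangle in a cycle would be oriented cyclically by next, or have a vertex with two
-- distinct successors.
cycle-triangle-free : ∀ {n} → 4 ≤ n → {x y z : Fin n} → Arc x y → Arc y z → Arc z x → ⊥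
cycle-triangle-free {n} 4≤n = cases
  where
  no-loop : {u v : Fin n} → u ≡ v → next u ≡ v → ⊥
  no-loop {u} u≡v arc = next-≢ (≤-trans (s≤s (s≤s z≤n)) 4≤n) u (trans u≡v (sym arc))

  cases : {x y z : Fin n} → Arc x y → Arc y z → Arc z x → ⊥
  cases (inj₁ refl) (inj₁ refl) (inj₁ r) = next³-≢ 4≤n _ r
  cases (inj₂ refl) (inj₂ refl) (inj₂ r) = next³-≢ 4≤n _ r
  cases (inj₁ p) (inj₁ q) (inj₂ r) = no-loop (trans (sym p) r) q
  cases (inj₁ p) (inj₂ q) (inj₁ r) = no-loop (trans (sym r) q) p
  cases (inj₁ p) (inj₂ q) (inj₂ r) = no-loop (trans (sym r) p) q
  cases (inj₂ p) (inj₁ q) (inj₁ r) = no-loop (trans (sym q) p) r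
  cases (inj₂ p) (inj₁ q) (inj₂ r) = no-loop (trans (sym p) q) r
  cases (inj₂ p) (inj₂ q) (inj₁ r) = no-loop (trans (sym q) r) p

-- Triangles of a wheel.

module _ {n : ℕ} (4≤n : 4 ≤ n) where
  private
    W : Graph
    W = wheel n (<⇒≤ 4≤n)

  open Graph W

  hubTriangle : Fin n → TriangleIn W
  hubTriangle i = record
    { corner   = λ { 0F → inj₁ tt ; 1F → inj₂ i ; 2F → inj₂ (next i) }
    ; side     = λ { 0F → inj₁ i ; 1F → inj₂ i ; 2F → inj₁ (next i) }
    ; incident = λ { 0F → inj₁ refl ; 1F → inj₁ refl ; 2F → inj₂ refl }
    }

  wheel-covered : TriangleCovered W
  wheel-covered (inj₁ i) = hubTriangle i , 0F , refl
  wheel-covered (inj₂ i) = hubTriangle i , 1F , refl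

  no-loop : ∀ {A : Set} e {v} → ends e ≈ (v , v) → A
  no-loop e (inj₁ eq) = contradiction (trans (cong proj₁ eq) (sym (cong proj₂ eq))) (loopless e)
  no-loop e (inj₂ eq) = contradiction (trans (cong proj₁ eq) (sym (cong proj₂ eq))) (loopless e)

  rim-arc : ∀ e {u v} → ends e ≈ (inj₂ u , inj₂ v) → Arc u v
  rim-arc (inj₂ i) (inj₁ refl) = inj₁ refl
  rim-arc (inj₂ i) (inj₂ refl) = inj₂ refl
  rim-arc (inj₁ i) (inj₁ ())
  rim-arc (inj₁ i) (inj₂ ())

  module _ {f : V → ℕ} {g : E → ℕ} {c : ℕ}
           (hub-magic : ∀ i → triangleWeight W f g (hubTriangle i) ≡ c) where

    private
      Sum₃ : (x y z : V) (e₀ e₁ e₂ : E) → Set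
      Sum₃ x y z e₀ e₁ e₂ = f x + (f y + (f z + 0)) + (g e₀ + (g e₁ + (g e₂ + 0))) ≡ c

      rotate : ∀ x y z {e₀ e₁ e₂} → Sum₃ y z x e₁ e₂ e₀ → Sum₃ x y z e₀ e₁ e₂
      rotate x y z {e₀} {e₁} {e₂} = trans (lemma (f x) (f y) (f z) (g e₀) (g e₁) (g e₂))
        where
        lemma : ∀ a b c d e f → a + (b + (c + 0)) + (d + (e + (f + 0))) ≡
                                b + (c + (a + 0)) + (e + (f + (d + 0)))
        lemma = solve-∀

      reflect : ∀ a b c d e f → a + (b + (c + 0)) + (d + (e + (f + 0))) ≡
                                a + (c + (b + 0)) + (f + (e + (d + 0)))
      reflect = solve-∀

      -- With the hub first, `e₀` and `e₂` are spokes and `e₁` is a rim edge. Traversed forwards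
      -- this is `hubTriangle i`; backwards it is its reflection.
      hub-case : ∀ {u w} e₀ e₁ e₂ → ends e₀ ≈ (inj₁ tt , inj₂ u) →
                 ends e₁ ≈ (inj₂ u , inj₂ w) → ends e₂ ≈ (inj₂ w , inj₁ tt) →
                 Sum₃ (inj₁ tt) (inj₂ u) (inj₂ w) e₀ e₁ e₂
      hub-case (inj₁ _) (inj₂ i) (inj₁ _) (inj₁ refl) (inj₁ refl) (inj₂ refl) = hub-magic i
      hub-case (inj₁ _) (inj₂ i) (inj₁ _) (inj₁ refl) (inj₂ refl) (inj₂ refl) =
        trans (reflect (f (inj₁ tt)) (f (inj₂ (next i))) (f (inj₂ i))
                       (g (inj₁ (next i))) (g (inj₂ i)) (g (inj₁ i)))
              (hub-magic i)
      hub-case (inj₂ _) _ _ (inj₁ ()) _ _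
      hub-case (inj₂ _) _ _ (inj₂ ()) _ _
      hub-case _ (inj₁ _) _ _ (inj₁ ()) _
      hub-case _ (inj₁ _) _ _ (inj₂ ()) _
      hub-case _ _ (inj₂ _) _ _ (inj₁ ())
      hub-case _ _ (inj₂ _) _ _ (inj₂ ())

      -- Split on which corners are the hub: two consecutive ones would give a loop, none would give
      -- a triangle in the rim, and a single one is rotated to the front.
      all-cases : ∀ x y z e₀ e₁ e₂ →
        ends e₀ ≈ (x , y) → ends e₁ ≈ (y , z) → ends e₂ ≈ (z , x) → Sum₃ x y z e₀ e₁ e₂
      all-cases (inj₁ tt) (inj₂ _) (inj₂ _) e₀ e₁ e₂ p q r = hub-case e₀ e₁ e₂ p q r
      all-cases x@(inj₂ _) y@(inj₂ _) z@(inj₁ tt) e₀ e₁ e₂ p q r =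
        rotate x y z (rotate y z x (hub-case e₂ e₀ e₁ r p q))
      all-cases x@(inj₂ _) y@(inj₁ tt) z@(inj₂ _) e₀ e₁ e₂ p q r =
        rotate x y z (hub-case e₁ e₂ e₀ q r p)
      all-cases (inj₂ _) (inj₂ _) (inj₂ _) e₀ e₁ e₂ p q r =
        ⊥-elim (cycle-triangle-free 4≤n (rim-arc e₀ p) (rim-arc e₁ q) (rim-arc e₂ r))
      all-cases (inj₁ tt) (inj₁ tt) _ e₀ e₁ e₂ p q r = no-loop e₀ p
      all-cases _ (inj₁ tt) (inj₁ tt) e₀ e₁ e₂ p q r = no-loop e₁ q
      all-cases (inj₁ tt) _ (inj₁ tt) e₀ e₁ e₂ p q r = no-loop e₂ r

    wheel-magic : TriangleMagic W f g
    wheel-magic = c , λ Δ → all-cases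
      (corner Δ 0F) (corner Δ 1F) (corner Δ 2F) (side Δ 0F) (side Δ 1F) (side Δ 2F)
      (incident Δ 0F) (incident Δ 1F) (incident Δ 2F)

-- The block labelling of a single wheel.

-- β and γ give the order of the labels of the first n₀ rim vertices and of the spokes and rim
-- edges starting there: these edge labels are split into a block of k and a block of l.
module Labelling
  (n₀ k l : ℕ) (n₀+n₀≡k+l : n₀ + n₀ ≡ k + l)
  (β : Fin n₀ ↔ Fin n₀) (γ : (Fin n₀ ⊎ Fin n₀) ↔ (Fin k ⊎ Fin l)) (g : ℕ)
  where
  private
    module β = Inverse β
    module γ = Inverse γ

  n : ℕ
  n = n₀ + g * 4

  Pos : Set
  Pos = Fin n₀ ⊎ Fin g × Fin 4

  pattern base b  = inj₁ b
  pattern run t u = inj₂ (t , u)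

  position : Numbers {Pos} _ n
  position = toℕ-numbers {n₀} ⊎-numbers toℕ-numbers {g} ×-numbers toℕ-numbers {4}

  VBlocks : Set
  VBlocks = Fin g ⊎ Fin g ⊎ Fin n₀ ⊎ Fin g ⊎ ⊤ ⊎ Fin g

  -- The run blocks ascend in `t`. Those of `0F` and `2F` meet descending spoke blocks and those of
  -- `1F` and `3F` ascending ones, whence the slopes 0 and 2 of `spokeSum`.
  vBlocks : Numbers {VBlocks} _ _
  vBlocks = toℕ-numbers ⊎-numbers toℕ-numbers ⊎-numbers toℕ-numbers ⊎-numbers toℕ-numbers
    ⊎-numbers transport (↔-sym 1↔⊤) toℕ-numbers ⊎-numbers toℕ-numbers

  vBlock : (⊤ ⊎ Pos) ↔ VBlocks
  vBlock = mk↔ₛ′ to from to-from from-to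
    where
    to : ⊤ ⊎ Pos → VBlocks
    to (inj₂ (run t 1F)) = inj₁ t
    to (inj₂ (run t 3F)) = inj₂ (inj₁ t)
    to (inj₂ (base b))   = inj₂ (inj₂ (inj₁ (β.to b)))
    to (inj₂ (run t 2F)) = inj₂ (inj₂ (inj₂ (inj₁ t)))
    to (inj₁ tt)         = inj₂ (inj₂ (inj₂ (inj₂ (inj₁ tt))))
    to (inj₂ (run t 0F)) = inj₂ (inj₂ (inj₂ (inj₂ (inj₂ t))))

    from : VBlocks → ⊤ ⊎ Pos
    from (inj₁ t)                             = inj₂ (run t 1F)
    from (inj₂ (inj₁ t))                      = inj₂ (run t 3F)
    from (inj₂ (inj₂ (inj₁ b)))               = inj₂ (base (β.from b))
    from (inj₂ (inj₂ (inj₂ (inj₁ t))))        = inj₂ (run t 2F)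
    from (inj₂ (inj₂ (inj₂ (inj₂ (inj₁ _))))) = inj₁ tt
    from (inj₂ (inj₂ (inj₂ (inj₂ (inj₂ t))))) = inj₂ (run t 0F)

    to-from : ∀ x → to (from x) ≡ x
    to-from (inj₁ _)                             = refl
    to-from (inj₂ (inj₁ _))                      = refl
    to-from (inj₂ (inj₂ (inj₁ b)))               = cong (inj₂ ∘ inj₂ ∘ inj₁) (β.strictlyInverseˡ b)
    to-from (inj₂ (inj₂ (inj₂ (inj₁ _))))        = refl
    to-from (inj₂ (inj₂ (inj₂ (inj₂ (inj₁ _))))) = refl
    to-from (inj₂ (inj₂ (inj₂ (inj₂ (inj₂ _))))) = refl

    from-to : ∀ x → from (to x) ≡ x
    from-to (inj₁ _)          = refl
    from-to (inj₂ (base b))   = cong (inj₂ ∘ inj₁) (β.strictlyInverseʳ b)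
    from-to (inj₂ (run _ 0F)) = refl
    from-to (inj₂ (run _ 1F)) = refl
    from-to (inj₂ (run _ 2F)) = refl
    from-to (inj₂ (run _ 3F)) = refl

  EBlocks : Set
  EBlocks = Fin g ⊎ Fin g ⊎ Fin k ⊎ Fin g × Fin 2 ⊎ Fin g × Fin 2 ⊎ Fin g ⊎ Fin g ⊎ Fin l

  -- `opposite-numbers` makes a block descend in `t`. The factor `Fin 2` interleaves two rim edges
  -- of each run, so that rim labels have slope -2 and cancel the slope 2 of the one neighbouring
  -- `spokeSum` that varies.
  eBlocks : Numbers {EBlocks} _ _
  eBlocks = opposite-numbers ⊎-numbers opposite-numbers ⊎-numbers toℕ-numbers
    ⊎-numbers opposite-numbers ×-numbers toℕ-numbers
    ⊎-numbers opposite-numbers ×-numbers toℕ-numbers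
    ⊎-numbers toℕ-numbers ⊎-numbers toℕ-numbers ⊎-numbers toℕ-numbers

  eBlock : (Pos ⊎ Pos) ↔ EBlocks
  eBlock = mk↔ₛ′ to from to-from from-to
    where
    exceptional : Fin k ⊎ Fin l → EBlocks
    exceptional (inj₁ x) = inj₂ (inj₂ (inj₁ x))
    exceptional (inj₂ y) = inj₂ (inj₂ (inj₂ (inj₂ (inj₂ (inj₂ (inj₂ y))))))

    to : Pos ⊎ Pos → EBlocks
    to (inj₁ (base b))   = exceptional (γ.to (inj₁ b))
    to (inj₂ (base b))   = exceptional (γ.to (inj₂ b))
    to (inj₁ (run t 0F)) = inj₁ t
    to (inj₁ (run t 2F)) = inj₂ (inj₁ t)
    to (inj₂ (run t 3F)) = inj₂ (inj₂ (inj₂ (inj₁ (t , 0F))))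
    to (inj₂ (run t 2F)) = inj₂ (inj₂ (inj₂ (inj₁ (t , 1F))))
    to (inj₂ (run t 0F)) = inj₂ (inj₂ (inj₂ (inj₂ (inj₁ (t , 0F)))))
    to (inj₂ (run t 1F)) = inj₂ (inj₂ (inj₂ (inj₂ (inj₁ (t , 1F)))))
    to (inj₁ (run t 1F)) = inj₂ (inj₂ (inj₂ (inj₂ (inj₂ (inj₁ t)))))
    to (inj₁ (run t 3F)) = inj₂ (inj₂ (inj₂ (inj₂ (inj₂ (inj₂ (inj₁ t))))))

    from : EBlocks → Pos ⊎ Pos
    from (inj₁ t)                                           = inj₁ (run t 0F)
    from (inj₂ (inj₁ t))                                    = inj₁ (run t 2F)
    from (inj₂ (inj₂ (inj₁ x)))                             = map-⊎ inj₁ inj₁ (γ.from (inj₁ x))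
    from (inj₂ (inj₂ (inj₂ (inj₁ (t , 0F)))))               = inj₂ (run t 3F)
    from (inj₂ (inj₂ (inj₂ (inj₁ (t , 1F)))))               = inj₂ (run t 2F)
    from (inj₂ (inj₂ (inj₂ (inj₂ (inj₁ (t , 0F))))))        = inj₂ (run t 0F)
    from (inj₂ (inj₂ (inj₂ (inj₂ (inj₁ (t , 1F))))))        = inj₂ (run t 1F)
    from (inj₂ (inj₂ (inj₂ (inj₂ (inj₂ (inj₁ t))))))        = inj₁ (run t 1F)
    from (inj₂ (inj₂ (inj₂ (inj₂ (inj₂ (inj₂ (inj₁ t))))))) = inj₁ (run t 3F)
    from (inj₂ (inj₂ (inj₂ (inj₂ (inj₂ (inj₂ (inj₂ y))))))) = map-⊎ inj₁ inj₁ (γ.from (inj₂ y))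

    -- As `γ` is arbitrary, `to` and `from` do not reduce on its values without a case split; this
    -- fact and the three after it isolate that split.
    to-base : ∀ b → to (map-⊎ inj₁ inj₁ b) ≡ exceptional (γ.to b)
    to-base (inj₁ _) = refl
    to-base (inj₂ _) = refl

    from-exceptional : ∀ x → from (exceptional x) ≡ map-⊎ inj₁ inj₁ (γ.from x)
    from-exceptional (inj₁ _) = refl
    from-exceptional (inj₂ _) = refl

    to-from-exceptional : ∀ x → to (map-⊎ inj₁ inj₁ (γ.from x)) ≡ exceptional x
    to-from-exceptional x = trans (to-base (γ.from x)) (cong exceptional (γ.strictlyInverseˡ x))

    from-to-base : ∀ b → from (exceptional (γ.to b)) ≡ map-⊎ inj₁ inj₁ b
    from-to-base b = trans (from-exceptional (γ.to b))
      (cong (map-⊎ inj₁ inj₁) (γ.strictlyInverseʳ b))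

    to-from : ∀ x → to (from x) ≡ x
    to-from (inj₁ _)                                           = refl
    to-from (inj₂ (inj₁ _))                                    = refl
    to-from (inj₂ (inj₂ (inj₁ x)))                             = to-from-exceptional (inj₁ x)
    to-from (inj₂ (inj₂ (inj₂ (inj₁ (_ , 0F)))))               = refl
    to-from (inj₂ (inj₂ (inj₂ (inj₁ (_ , 1F)))))               = refl
    to-from (inj₂ (inj₂ (inj₂ (inj₂ (inj₁ (_ , 0F))))))        = refl
    to-from (inj₂ (inj₂ (inj₂ (inj₂ (inj₁ (_ , 1F))))))        = refl
    to-from (inj₂ (inj₂ (inj₂ (inj₂ (inj₂ (inj₁ _))))))        = refl
    to-from (inj₂ (inj₂ (inj₂ (inj₂ (inj₂ (inj₂ (inj₁ _))))))) = refl
    to-from (inj₂ (inj₂ (inj₂ (inj₂ (inj₂ (inj₂ (inj₂ y))))))) = to-from-exceptional (inj₂ y)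

    from-to : ∀ x → from (to x) ≡ x
    from-to (inj₁ (base b))   = from-to-base (inj₁ b)
    from-to (inj₂ (base b))   = from-to-base (inj₂ b)
    from-to (inj₁ (run _ 0F)) = refl
    from-to (inj₁ (run _ 1F)) = refl
    from-to (inj₁ (run _ 2F)) = refl
    from-to (inj₁ (run _ 3F)) = refl
    from-to (inj₂ (run _ 0F)) = refl
    from-to (inj₂ (run _ 1F)) = refl
    from-to (inj₂ (run _ 2F)) = refl
    from-to (inj₂ (run _ 3F)) = refl

  vLabel : ⊤ ⊎ Pos → ℕ
  vLabel = Numbers.value vBlocks ∘ Inverse.to vBlock

  vLabel-numbers : Numbers vLabel (1 + n)
  vLabel-numbers = subst (Numbers _) (size g n₀) (transport vBlock vBlocks)
    where
    size : ∀ g n₀ → g + (g + (n₀ + (g + (1 + g)))) ≡ 1 + (n₀ + g * 4)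
    size = solve-∀

  eLabel : Pos ⊎ Pos → ℕ
  eLabel = Numbers.value eBlocks ∘ Inverse.to eBlock

  eLabel-numbers : Numbers eLabel (n + n)
  eLabel-numbers = subst (Numbers _)
    (trans (regroup g k l) (trans (cong (_+ 8 * g) (sym n₀+n₀≡k+l)) (size g n₀)))
    (transport eBlock eBlocks)
    where
    regroup : ∀ g k l → g + (g + (k + (g * 2 + (g * 2 + (g + (g + l)))))) ≡ k + l + 8 * g
    regroup = solve-∀
    size : ∀ g n₀ → n₀ + n₀ + 8 * g ≡ n₀ + g * 4 + (n₀ + g * 4)
    size = solve-∀

  spokeSum : Pos → ℕ
  spokeSum p = vLabel (inj₂ p) + eLabel (inj₁ p)

  start : ℕ
  start = 4 * g + n₀

  -- The 2 is moved to the left to avoid truncated subtraction.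
  Balanced : Pos → ℕ → Set
  Balanced p x = spokeSum p + x + eLabel (inj₂ p) + 2 ≡ 16 * g + n₀ + 2 * k

  spokeSum-0F : ∀ t → spokeSum (run t 0F) ≡ start
  spokeSum-0F t = lemma g (toℕ t) (toℕ (opposite t)) (toℕ+opposite t)
    where
    lemma : ∀ g t t′ → suc (t + t′) ≡ g →
            g + (g + (n₀ + (g + (1 + t)))) + t′ ≡ 4 * g + n₀
    -- Eliminating `g` in favour of `suc (t + t′)` leaves an identity without subtraction for the
    -- ring solver; the four balance identities use the same device.
    lemma _ t t′ refl = solve (n₀ ∷ t ∷ t′ ∷ [])

  balanced-0F : ∀ t → Balanced (run t 0F) (spokeSum (run t 1F))
  balanced-0F t rewrite spokeSum-0F t = lemma g (toℕ t) (toℕ (opposite t)) (toℕ+opposite t)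
    where
    lemma : ∀ g t t′ → suc (t + t′) ≡ g →
            4 * g + n₀ + (t + (g + (g + (k + (g * 2 + (g * 2 + t)))))) +
              (g + (g + (k + (g * 2 + (2 * t′ + 0))))) + 2 ≡ 16 * g + n₀ + 2 * k
    lemma _ t t′ refl = solve (n₀ ∷ k ∷ t ∷ t′ ∷ [])

  balanced-1F : ∀ t → Balanced (run t 1F) (spokeSum (run t 2F))
  balanced-1F t = lemma g (toℕ t) (toℕ (opposite t)) (toℕ+opposite t)
    where
    lemma : ∀ g t t′ → suc (t + t′) ≡ g →
            t + (g + (g + (k + (g * 2 + (g * 2 + t))))) + (g + (g + (n₀ + t)) + (g + t′)) +
              (g + (g + (k + (g * 2 + (2 * t′ + 1))))) + 2 ≡ 16 * g + n₀ + 2 * k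
    lemma _ t t′ refl = solve (n₀ ∷ k ∷ t ∷ t′ ∷ [])

  balanced-2F : ∀ t → Balanced (run t 2F) (spokeSum (run t 3F))
  balanced-2F t = lemma g (toℕ t) (toℕ (opposite t)) (toℕ+opposite t)
    where
    lemma : ∀ g t t′ → suc (t + t′) ≡ g →
            g + (g + (n₀ + t)) + (g + t′) +
              (g + t + (g + (g + (k + (g * 2 + (g * 2 + (g + t))))))) +
              (g + (g + (k + (2 * t′ + 1)))) + 2 ≡ 16 * g + n₀ + 2 * k
    lemma _ t t′ refl = solve (n₀ ∷ k ∷ t ∷ t′ ∷ [])

  balanced-3F : ∀ t → Balanced (run t 3F) start
  balanced-3F t = lemma g (toℕ t) (toℕ (opposite t)) (toℕ+opposite t)
    where
    lemma : ∀ g t t′ → suc (t + t′) ≡ g →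
            g + t + (g + (g + (k + (g * 2 + (g * 2 + (g + t)))))) + (4 * g + n₀) +
              (g + (g + (k + (2 * t′ + 0)))) + 2 ≡ 16 * g + n₀ + 2 * k
    lemma _ t t′ refl = solve (n₀ ∷ k ∷ t ∷ t′ ∷ [])

  -- Balance around the whole rim.

  module _
    (base-start : ∀ b → toℕ b ≡ 0 → spokeSum (base b) ≡ start)
    (base-balanced : ∀ b →
      (∃[ b′ ] (toℕ b′ ≡ suc (toℕ b)) × Balanced (base b) (spokeSum (base b′))) ⊎
      -- The last base vertex is followed by the first run or, if there is none, by the first base
      -- vertex; both have sum `start`.
      (suc (toℕ b) ≡ n₀ × Balanced (base b) start))
    where
    private
      module P = Numbers position

      toℕ≡ : ∀ i → toℕ i ≡ P.value (P.from i)
      toℕ≡ i = sym (P.toℕ-from i)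

      from-toℕ : ∀ {i q} → P.value q ≡ toℕ i → P.from i ≡ q
      from-toℕ {i} {q} eq = trans
        (cong P.from (toℕ-injective (trans (sym eq) (sym (P.toℕ-to q))))) (P.strictlyInverseʳ q)

      -- The value of `q` is below `n`, so `i` is not the last position and `next` does not wrap
      -- around.
      value-next : ∀ i q → P.value q ≡ suc (toℕ i) → P.from (next i) ≡ q
      value-next i q eq with toℕ-next i
      ... | inj₁ p       = from-toℕ (trans eq (sym p))
      ... | inj₂ (p , _) = contradiction (trans eq p) (<⇒≢ (P.bounded q))

      spokeSum-first : ∀ i → toℕ i ≡ 0 → spokeSum (P.from i) ≡ start
      spokeSum-first i i≡0 = cases (P.from i) (trans (sym (toℕ≡ i)) i≡0)
        where
        cases : ∀ p → P.value p ≡ 0 → spokeSum p ≡ start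
        cases (base b)        eq = base-start b eq
        cases (run t 0F)      _  = spokeSum-0F t
        cases (run t (suc u)) eq =
          contradiction (m+n≡0⇒n≡0 (4 * toℕ t) (m+n≡0⇒n≡0 n₀ eq)) λ ()

      -- Treats the end of the base (`x` zero) and the ends of runs together: the successor starts
      -- run `x` if that exists, and otherwise is position 0.
      spokeSum-next : ∀ i x → suc (toℕ i) ≡ n₀ + 4 * x → spokeSum (P.from (next i)) ≡ start
      spokeSum-next i x eq with x <? g
      ... | yes x<g = trans
        (cong spokeSum (value-next i (run (fromℕ< x<g) 0F)
          (trans (cong (n₀ +_) (trans (+-identityʳ _) (cong (4 *_) (toℕ-fromℕ< x<g)))) (sym eq))))
        (spokeSum-0F (fromℕ< x<g))
      ... | no x≮g with toℕ-next i
      ...   | inj₂ (_ , next≡0) = spokeSum-first (next i) next≡0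
      -- Without a wrap the successor would have index `n₀ + 4 * x`, which is at least `n`.
      ...   | inj₁ p = contradiction (toℕ<n (next i))
        (≤⇒≯ (subst₂ _≤_ (cong (n₀ +_) (*-comm 4 g)) (sym (trans p eq))
          (+-monoʳ-≤ n₀ (*-monoʳ-≤ 4 (≮⇒≥ x≮g)))))

      within-run : ∀ i t u u′ → toℕ i ≡ P.value (run t u) → toℕ u′ ≡ suc (toℕ u) →
                   Balanced (run t u) (spokeSum (run t u′)) →
                   Balanced (run t u) (spokeSum (P.from (next i)))
      within-run i t u u′ eq u′≡1+u = subst (Balanced (run t u))
        (cong spokeSum (sym (value-next i (run t u′) value≡)))
        where
        shift : ∀ n₀ t u → n₀ + (4 * t + suc u) ≡ suc (n₀ + (4 * t + u))
        shift = solve-∀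

        value≡ : P.value (run t u′) ≡ suc (toℕ i)
        value≡ = trans (cong (λ x → n₀ + (4 * toℕ t + x)) u′≡1+u)
          (trans (shift n₀ (toℕ t) (toℕ u)) (cong suc (sym eq)))

      next-run : ∀ n₀ t → suc (n₀ + (4 * t + 3)) ≡ n₀ + 4 * suc t
      next-run = solve-∀

      -- The position `p` is tied to `i` only by its value, so it can be matched on while `next i`
      -- stays intact.
      balanced : ∀ i p → toℕ i ≡ P.value p → Balanced p (spokeSum (P.from (next i)))
      balanced i (base b) eq with base-balanced b
      ... | inj₁ (b′ , b′≡1+b , bal) = subst (Balanced (base b))
        (cong spokeSum (sym (value-next i (base b′) (trans b′≡1+b (cong suc (sym eq)))))) bal
      ... | inj₂ (1+b≡n₀ , bal) = subst (Balanced (base b))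
        (sym (spokeSum-next i 0 (trans (cong suc eq) (trans 1+b≡n₀ (sym (+-identityʳ n₀)))))) bal
      balanced i (run t 0F) eq = within-run i t 0F 1F eq refl (balanced-0F t)
      balanced i (run t 1F) eq = within-run i t 1F 2F eq refl (balanced-1F t)
      balanced i (run t 2F) eq = within-run i t 2F 3F eq refl (balanced-2F t)
      balanced i (run t 3F) eq = subst (Balanced (run t 3F))
        (sym (spokeSum-next i (suc (toℕ t)) (trans (cong suc eq) (next-run n₀ (toℕ t)))))
        (balanced-3F t)

    copies-wheel-supermagic : ∀ m (4≤n : 4 ≤ n) →
      IsSupermagic (cycle 3 ≤-refl) (copies m (wheel n (<⇒≤ 4≤n)))
    copies-wheel-supermagic m 4≤n = copies-supermagic m (wheel n (<⇒≤ 4≤n)) {f} {h}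
      (transport (↔-id _ ⊎-↔ rim) vLabel-numbers) (transport (rim ⊎-↔ rim) eLabel-numbers)
      (wheel-covered 4≤n) (wheel-magic 4≤n {f} {h} hub-magic)
      where
      rim : Fin n ↔ Pos
      rim = ↔-sym P.index

      f : ⊤ ⊎ Fin n → ℕ
      f = vLabel ∘ Inverse.to (↔-id ⊤ ⊎-↔ rim)

      h : Fin n ⊎ Fin n → ℕ
      h = eLabel ∘ Inverse.to (rim ⊎-↔ rim)

      c : ℕ
      c = 16 * g + n₀ + 2 * k ∸ 2

      regroup : ∀ x v v′ s r s′ →
        x + (v + (v′ + 0)) + (s + (r + (s′ + 0))) ≡ x + (v + s + (v′ + s′) + r)
      regroup = solve-∀

      hub-magic : ∀ i → triangleWeight (wheel n (<⇒≤ 4≤n)) f h (hubTriangle 4≤n i) ≡ f (inj₁ tt) + c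
      hub-magic i = trans
        (regroup (f (inj₁ tt)) (f (inj₂ i)) (f (inj₂ (next i)))
                 (h (inj₁ i)) (h (inj₂ i)) (h (inj₁ (next i))))
        (cong (f (inj₁ tt) +_) (trans
          (sym (m+n∸n≡m (spokeSum (P.from i) + spokeSum (P.from (next i)) + h (inj₂ i)) 2))
          (cong (_∸ 2) (balanced i (P.from i) (toℕ≡ i)))))

-- The two residues of n modulo four.

open Labelling using (copies-wheel-supermagic)

copies-wheel-4g : ∀ g m (4≤n : 4 ≤ g * 4) →
  IsSupermagic (cycle 3 ≤-refl) (copies m (wheel (g * 4) (<⇒≤ 4≤n)))
-- The rim consists of runs only, so both conditions on the base are vacuous over `Fin 0`.
copies-wheel-4g g = copies-wheel-supermagic 0 0 0 refl (↔-id _) (↔-id _) g (λ ()) (λ ())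

module SixExceptions where
  -- For `g` zero these tables label W_6: the sums a_i are 6, 10, 9, 12, 3, 11 and the rim labels 6,
  -- 3, 1, 7, 8, 5, so a_i + a_{i+1} + r_i is always 22.
  β : Fin 6 ↔ Fin 6
  β = mk↔ₛ′ (lookup to) (lookup from)
    (toWitness {a? = all? λ i → lookup to (lookup from i) ≟ i} _)
    (toWitness {a? = all? λ i → lookup from (lookup to i) ≟ i} _)
    where
    to from : List (Fin 6)
    to   = 4F ∷ 1F ∷ 5F ∷ 2F ∷ 3F ∷ 0F ∷ []
    from = 5F ∷ 1F ∷ 3F ∷ 4F ∷ 0F ∷ 2F ∷ []

  -- The block of 3 holds exactly the spokes at odd base vertices. Every base rim edge thus meets
  -- one high spoke, which gives all these sums the same coefficient of `g`.
  γ : (Fin 6 ⊎ Fin 6) ↔ (Fin 9 ⊎ Fin 3)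
  γ = mk↔ₛ′ to from
    [ toWitness {a? = all? λ x → to (from (inj₁ x)) ≟⊎ inj₁ x} _
    , toWitness {a? = all? λ y → to (from (inj₂ y)) ≟⊎ inj₂ y} _ ]
    [ toWitness {a? = all? λ x → from (to (inj₁ x)) ≟⊎ inj₁ x} _
    , toWitness {a? = all? λ y → from (to (inj₂ y)) ≟⊎ inj₂ y} _ ]
    where
    _≟⊎_ : ∀ {a b} → DecidableEquality (Fin a ⊎ Fin b)
    _≟⊎_ = ≡-dec _≟_ _≟_

    spokes rims : List (Fin 9 ⊎ Fin 3)
    spokes = inj₁ 2F ∷ inj₂ 0F ∷ inj₁ 4F ∷ inj₂ 1F ∷ inj₁ 0F ∷ inj₂ 2F ∷ []
    rims   = inj₁ 6F ∷ inj₁ 3F ∷ inj₁ 1F ∷ inj₁ 7F ∷ inj₁ 8F ∷ inj₁ 5F ∷ []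

    to : Fin 6 ⊎ Fin 6 → Fin 9 ⊎ Fin 3
    to = [ lookup spokes , lookup rims ]

    low : List (Fin 6 ⊎ Fin 6)
    low = inj₁ 4F ∷ inj₂ 2F ∷ inj₁ 0F ∷ inj₂ 1F ∷ inj₁ 2F ∷
          inj₂ 5F ∷ inj₂ 0F ∷ inj₂ 3F ∷ inj₂ 4F ∷ []

    high : List (Fin 6 ⊎ Fin 6)
    high = inj₁ 1F ∷ inj₁ 3F ∷ inj₁ 5F ∷ []

    from : Fin 9 ⊎ Fin 3 → Fin 6 ⊎ Fin 6
    from = [ lookup low , lookup high ]

copies-wheel-6+4g : ∀ g m (4≤n : 4 ≤ 6 + g * 4) →
  IsSupermagic (cycle 3 ≤-refl) (copies m (wheel (6 + g * 4) (<⇒≤ 4≤n)))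
copies-wheel-6+4g g = copies-wheel-supermagic 6 9 3 refl β γ g
  (λ { 0F _ → first g })
  λ where
    0F → inj₁ (1F , refl , even-step 4 2 1 0 6 refl)
    1F → inj₁ (2F , refl , odd-step 5 4 1 0 3 refl)
    2F → inj₁ (3F , refl , even-step 5 4 2 1 1 refl)
    3F → inj₁ (4F , refl , odd-step 3 0 2 1 7 refl)
    4F → inj₁ (5F , refl , even-step 3 0 0 2 8 refl)
    -- The sixth vertex is balanced against vertex 0, whose sum `low 4 + low 2` is rewritten to
    -- `start`.
    5F → inj₂ (refl , subst (λ x → low 0 + high 2 + x + low 5 + 2 ≡ 16 * g + 6 + 2 * 9)
                        (first g) (odd-step 4 2 0 2 5 refl))
  where
  open SixExceptions

  low high : ℕ → ℕ
  low  x = g + (g + x)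
  high y = g + (g + (9 + (g * 2 + (g * 2 + (g + (g + y))))))

  first : ∀ g → g + (g + 4) + (g + (g + 2)) ≡ 4 * g + 6
  first = solve-∀

  -- Four labels lie in blocks that begin at 2g and the high spoke in one that begins at 8g + 9;
  -- with the 2 of `Balanced` this leaves 16g + 11 besides the offsets.
  expand : ∀ g a b c d e →
    g + (g + a) + (g + (g + b)) +
      (g + (g + c) + (g + (g + (9 + (g * 2 + (g * 2 + (g + (g + d)))))))) + (g + (g + e)) + 2 ≡
    16 * g + (a + b + c + d + e) + 11
  expand = solve-∀

  -- Here `a`, `b` are the vertex and spoke offsets at the even vertex, `c`, `d` those at the odd
  -- one and `e` that of the rim edge. Their sum must be 6 + 2 · 9 - 11 = 13.
  even-step : ∀ a b c d e → a + b + c + d + e ≡ 13 →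
    low a + low b + (low c + high d) + low e + 2 ≡ 16 * g + 6 + 2 * 9
  even-step a b c d e sum≡13 = trans (expand g a b c d e)
    (trans (cong (λ s → 16 * g + s + 11) sum≡13)
           (trans (+-assoc (16 * g) 13 11) (sym (+-assoc (16 * g) 6 18))))

  odd-step : ∀ a b c d e → a + b + c + d + e ≡ 13 →
    low c + high d + (low a + low b) + low e + 2 ≡ 16 * g + 6 + 2 * 9
  odd-step a b c d e sum≡13 = trans
    (cong (λ x → x + low e + 2) (+-comm (low c + high d) (low a + low b)))
    (even-step a b c d e sum≡13)

data EvenView : ℕ → Set where
  two   : EvenView 2
  4g    : ∀ g → EvenView (g * 4)
  6+4g  : ∀ g → EvenView (6 + g * 4)

-- Adding 4 preserves `4g` and `6+4g` and sends `two` to `6+4g 0`, so 2 is the only even number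
-- outside both families; `4 ≤ n` excludes it.
evenView : ∀ q → EvenView (q * 2)
evenView 0 = 4g 0
evenView 1 = two
evenView (suc (suc q)) with q * 2 | evenView q
... | _ | two    = 6+4g 0
... | _ | 4g g   = 4g (suc g)
... | _ | 6+4g g = 6+4g (suc g)

theorem6 : (n m : ℕ) (4≤n : 4 ≤ n) → 2 ∣ n → 2 ≤ m →
    IsSupermagic (cycle 3 ≤-refl) (copies m (wheel n (<⇒≤ 4≤n)))
theorem6 _ m 4≤n (divides q refl) _ with q * 2 | evenView q | 4≤n
... | _ | two    | s≤s (s≤s ())
... | _ | 4g g   | 4≤n′ = copies-wheel-4g g m 4≤n′
... | _ | 6+4g g | 4≤n′ = copies-wheel-6+4g g m 4≤n′
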